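{- For every integer $k$, there exists a strongly connected digraph $D$ with $\chi(D)>k$ that contains no $3$-spindle and no $(2+2)$-bispindle (as a subdigraph).
   Context: Digraphs are finite, without loops or parallel arcs (two opposite arcs $uv$, $vu$ are allowed). The chromatic number $\chi(D)$ of a digraph $D$ is the chromatic number of its underlying undirected graph. A digraph is strongly connected if for any two vertices $x,y$ there is a directed path from $x$ to $y$. For distinct vertices $x,y$, a $p$-spindle with tail $x$ and head $y$ is a union of $p$ pairwise internally vertex-disjoint directed paths from $x$ to $y$. A $(p+q)$-bispindle is the union of $p$ directed $(x,y)$-paths and $q$ directed $(y,x)$-paths for some distinct vertices $x,y$, all these $p+q$ directed paths being pairwise internally vertex-disjoint. -}

module Defs where

open import Data.Fin.Base using (Fin)
open import Data.List.Base using (List; _∷_; _∷ʳ_)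
open import Data.List.Relation.Binary.Disjoint.Propositional using (Disjoint)
open import Data.List.Relation.Unary.Linked using (Linked)
open import Data.List.Relation.Unary.Unique.Propositional using (Unique)
open import Data.Nat.Base using (ℕ; _≤_)
open import Data.Product.Base using (_×_; Σ-syntax; ∃-syntax)
open import Level using (0ℓ)
open import Relation.Binary.Construct.Closure.Symmetric using (SymClosure)
open import Relation.Binary.Core using (Rel)
open import Relation.Binary.Definitions using (Decidable; Irreflexive)
open import Relation.Binary.PropositionalEquality.Core using (_≡_; _≢_)

-- Arcs form a relation, so there are no parallel arcs; opposite arcs are
-- allowed.  Decidability makes the arc set a finite set constructively.
record Digraph : Set₁ where
  infix 4 _⟶_ _⟶?_
  field
    order    : ℕ
    _⟶_      : Rel (Fin order) 0ℓ
    _⟶?_     : Decidable _⟶_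
    loopless : Irreflexive _≡_ _⟶_

  Vertex : Set
  Vertex = Fin order

  Adjacent : Rel Vertex 0ℓ
  Adjacent = SymClosure _⟶_

  Colourable : ℕ → Set
  Colourable m =
    Σ[ c ∈ (Vertex → Fin m) ] (∀ u v → Adjacent u v → c u ≢ c v)

  IsChromaticNumber : ℕ → Set
  IsChromaticNumber m = Colourable m × (∀ n → Colourable n → m ≤ n)

  -- A directed path with at least one arc.  By uniqueness of its vertices its
  -- ends are distinct; the paths below only ever join distinct vertices.
  record Path (x y : Vertex) : Set where
    field
      internal : List Vertex

    vertices : List Vertex
    vertices = x ∷ (internal ∷ʳ y)

    field
      linked : Linked _⟶_ vertices
      unique : Unique vertices

  open Path public using (internal)

  -- The trivial path from a vertex to itself needs no hypothesis.
  StronglyConnected : Set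
  StronglyConnected = ∀ x y → x ≢ y → Path x y

  -- The paths of a spindle share both ends, so they are internally
  -- vertex-disjoint exactly when their internal vertices are disjoint.
  -- Distinctness rules out repeating the path consisting of the single arc
  -- from x to y, which is internally disjoint from itself.
  record SpindlePaths (p : ℕ) (x y : Vertex) : Set where
    field
      path     : Fin p → Path x y
      distinct : ∀ {i j} → i ≢ j → internal (path i) ≢ internal (path j)
      disjoint : ∀ {i j} → i ≢ j →
                 Disjoint (internal (path i)) (internal (path j))

  open SpindlePaths public using (path)

  ContainsSpindle : ℕ → Set
  ContainsSpindle p = ∃[ x ] ∃[ y ] (x ≢ y × SpindlePaths p x y)

  ContainsBispindle : ℕ → ℕ → Set
  ContainsBispindle p q =
    ∃[ x ] ∃[ y ] (x ≢ y ×
      Σ[ P ∈ SpindlePaths p x y ] Σ[ Q ∈ SpindlePaths q y x ]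
        (∀ i j → Disjoint (internal (path P i)) (internal (path Q j))))

{-# OPTIONS --safe #-}

-- Zykov's graphs, with every arc pointing to the younger vertex, have unbounded
-- chromatic number, and distinct in-neighbours of a vertex never have a common
-- ancestor.  To make such a graph strong, let a directed path of "entries" send
-- an arc to each vertex, let each vertex send an arc to a directed path of
-- "exits", and join the last exit to the first entry.  Every directed cycle
-- uses this last arc, so two arc-disjoint cycles cannot exist, which
-- excludes (2+2)-bispindles.  Entries and exits have in- and out-degree at most
-- 2, so the ends of a 3-spindle are vertices of the Zykov graph; two of its three
-- paths avoid the first entry, hence stay in the Zykov graph and end in the same
-- arc.
module Submission where

open import Defs
open import Data.Empty using (⊥)
open import Data.Fin.Base as Fin using (Fin; zero; suc; toℕ; fromℕ; inject≤; finToFun; funToFin)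
open import Data.Fin.Induction using (<-weakInduction; >-weakInduction)
open import Data.Fin.Properties as Fin using (all?; ¬∀⟶∃¬; pigeonhole; injective⇒≤; +↔⊎; *↔×; 0↔⊥; 1↔⊤; <⇒≢; toℕ<n; toℕ-inject₁; toℕ-injective; inject≤-injective; finToFun-funToFin)
open import Data.Integer.Base using (ℤ; +_; -[1+_]; _>_; ∣_∣)
import Data.Integer.Base as ℤ
import Data.Integer.Properties as ℤ
open import Data.List.Base using (List; []; _∷_; _∷ʳ_)
open import Data.List.Membership.Propositional using (_∈_; _∉_)
open import Data.List.Membership.Propositional.Properties using (∈-++⁺ˡ; ∈-++⁺ʳ)
open import Data.List.Relation.Binary.Disjoint.Propositional using (Disjoint)
open import Data.List.Relation.Unary.All as All using (All; []; _∷_)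
open import Data.List.Relation.Unary.All.Properties using (¬Any⇒All¬)
open import Data.List.Relation.Unary.AllPairs using ([]; _∷_)
open import Data.List.Relation.Unary.Any using (here; there)
open import Data.List.Relation.Unary.Linked using (Linked; [-]; _∷_)
open import Data.List.Relation.Unary.Unique.Propositional using (Unique)
open import Data.Nat.Base using (ℕ; zero; suc; _+_; _≤_; _<_; s≤s⁻¹; z≤n)
open import Data.Nat.Properties as ℕ using (≤-refl; ≤-trans; <-trans; <⇒≤; <-irrefl; ≮⇒≥; ≤-<-trans; m≤m+n; <-≤-trans; +-monoʳ-<; 1+n≢n; 1+n≰n; n<1+n; m<n⇒m<1+n; suc-injective)
open import Data.Product.Base using (_×_; _,_; proj₁; proj₂; Σ-syntax; ∃; ∃-syntax)
open import Data.Product.Function.NonDependent.Propositional using (_×-↔_)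
open import Data.Sum.Base using (_⊎_; inj₁; inj₂)
open import Data.Sum.Function.Propositional using (_⊎-↔_)
open import Data.Sum.Relation.Binary.Pointwise using (Pointwise; inj₁; inj₂; ⊎-decidable)
open import Data.Unit.Base using (⊤; tt)
open import Function.Base using (_∘_; _on_; id)
open import Function.Bundles using (_↔_; Inverse; mk↔ₛ′)
open import Function.Construct.Identity using (↔-id)
open import Function.Definitions using (Injective)
open import Function.Properties.Inverse using (↔-sym; ↔-trans; ↔⇒↣)
open import Level using (0ℓ)
open import Relation.Binary.Construct.Closure.ReflexiveTransitive using (Star; ε; _◅_; _◅◅_; gmap)
open import Relation.Binary.Construct.Closure.Symmetric using (fwd; bwd)
open import Relation.Binary.Core using (Rel; _=[_]⇒_)
open import Relation.Binary.Definitions using (Decidable; DecidableEquality)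
open import Relation.Binary.PropositionalEquality.Core using (_≡_; _≢_; refl; sym; trans; cong; subst; subst₂)
open import Relation.Nullary.Decidable using (Dec; yes; no; map′; _×-dec_; _→-dec_; ¬?; via-injection)
open import Relation.Nullary.Negation.Core using (¬_; contradiction)

private
  variable
    A B P I : Set
    R S : Rel A 0ℓ
    x y : A
    xs ys : List A
    k m n : ℕ

-- Vertex lists of paths

penultimate : A → List A → A
penultimate x []       = x
penultimate x (z ∷ zs) = penultimate z zs

penultimate-∈ : ∀ (z : A) zs → penultimate z zs ∈ z ∷ zs
penultimate-∈ z []       = here refl
penultimate-∈ z (w ∷ zs) = there (penultimate-∈ w zs)

penultimate-arc : ∀ xs → Linked R (x ∷ (xs ∷ʳ y)) → R (penultimate x xs) y
penultimate-arc []       (r ∷ [-]) = r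
penultimate-arc (z ∷ xs) (_ ∷ rs)  = penultimate-arc xs rs

-- The penultimate vertex of a path is internal, unless the path is a single arc, when it is the
-- tail `x`. Disjointness separates two internal vertices, `x ∉ xs` and `x ∉ ys` separate an
-- internal vertex from `x`, and `xs ≢ ys` excludes two single arcs.
penultimate-≢ : ∀ xs ys → x ∉ xs → x ∉ ys → xs ≢ ys → Disjoint xs ys →
                penultimate x xs ≢ penultimate x ys
penultimate-≢ []       []       _    _    xs≢ys _   _  = xs≢ys refl
penultimate-≢ []       (y ∷ ys) _    x∉ys _     _   eq =
  x∉ys (subst (_∈ y ∷ ys) (sym eq) (penultimate-∈ y ys))
penultimate-≢ (x ∷ xs) []       x∉xs _    _     _   eq =
  x∉xs (subst (_∈ x ∷ xs) eq (penultimate-∈ x xs))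
penultimate-≢ (x ∷ xs) (y ∷ ys) _    _    _     dis eq =
  dis (penultimate-∈ x xs , subst (_∈ y ∷ ys) (sym eq) (penultimate-∈ y ys))

second : List A → A → A
second []       y = y
second (z ∷ zs) y = z

second-arc : ∀ xs → Linked R (x ∷ (xs ∷ʳ y)) → R x (second xs y)
second-arc []       (r ∷ _) = r
second-arc (z ∷ xs) (r ∷ _) = r

second-≢ : ∀ xs ys → y ∉ xs → y ∉ ys → xs ≢ ys → Disjoint xs ys →
           second xs y ≢ second ys y
second-≢ []       []       _    _    xs≢ys _   _    = xs≢ys refl
second-≢ []       (_ ∷ _)  _    y∉ys _     _   refl = y∉ys (here refl)
second-≢ (_ ∷ _)  []       y∉xs _    _     _   refl = y∉xs (here refl)
second-≢ (_ ∷ _)  (_ ∷ _)  _    _    _     dis refl = dis (here refl , here refl)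

Unique⇒head∉ : Unique (x ∷ (xs ∷ʳ y)) → x ∉ xs
Unique⇒head∉ (x≢ ∷ _) x∈xs = All.lookup x≢ (∈-++⁺ˡ x∈xs) refl

Unique⇒last∉ : ∀ xs → Unique (xs ∷ʳ y) → y ∉ xs
Unique⇒last∉ (x ∷ xs) (x≢ ∷ _) (here refl)  = All.lookup x≢ (∈-++⁺ʳ xs (here refl)) refl
Unique⇒last∉ (x ∷ xs) (_ ∷ u)  (there y∈xs) = Unique⇒last∉ xs u y∈xs

-- Stops before the last arc, because `Q` is known for the internal vertices only and may fail at
-- `y`.
Linked⇒Star : ∀ {Q : A → Set} xs → Linked R (x ∷ (xs ∷ʳ y)) → All Q xs →
              Star (λ a b → R a b × Q b) x (penultimate x xs)
Linked⇒Star []       _        []       = ε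
Linked⇒Star (z ∷ xs) (r ∷ rs) (q ∷ qs) = (r , q) ◅ Linked⇒Star xs rs qs

-- Paths and spindles in a digraph

module DigraphProperties (D : Digraph) where
  open Digraph D

  open import Data.List.Membership.DecPropositional (Fin._≟_ {order}) using (_∈?_)

  -- Cuts off the loop when a walk returns to a vertex `x` that the path built so far already
  -- contains.
  suffix : ∀ {x y} xs → x ∈ xs ∷ʳ y → x ≢ y → Linked _⟶_ (xs ∷ʳ y) → Unique (xs ∷ʳ y) → Path x y
  suffix []       (here x≡y)  x≢y _        _       = contradiction x≡y x≢y
  suffix (x ∷ xs) (here refl) _   rs       u       = record { internal = xs ; linked = rs ; unique = u }
  -- The tail is split once more so that `_∷ʳ_` reduces to a cons and the `Linked` proof can be
  -- matched.
  suffix (_ ∷ [])        (there x∈) x≢y (_ ∷ rs) (_ ∷ u) = suffix [] x∈ x≢y rs u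
  suffix (_ ∷ xs@(_ ∷ _)) (there x∈) x≢y (_ ∷ rs) (_ ∷ u) = suffix xs x∈ x≢y rs u

  Star⇒Path : ∀ {x y} → Star _⟶_ x y → x ≢ y → Path x y
  Star⇒Path ε x≢x = contradiction refl x≢x
  Star⇒Path {x} {y} (_◅_ {j = z} x⟶z z⟶*y) x≢y with z Fin.≟ y
  ... | yes refl = record
    { internal = [] ; linked = x⟶z ∷ [-] ; unique = (x≢y ∷ []) ∷ [] ∷ [] }
  ... | no  z≢y = prepend (Star⇒Path z⟶*y z≢y)
    where
    prepend : Path z y → Path x y
    prepend p with x ∈? Path.vertices p
    ... | yes x∈p = suffix (z ∷ internal p) x∈p x≢y (Path.linked p) (Path.unique p)
    ... | no  x∉p = record
      { internal = z ∷ internal p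
      ; linked   = x⟶z ∷ Path.linked p
      ; unique   = ¬Any⇒All¬ _ x∉p ∷ Path.unique p
      }

  module _ {p x y} (S : SpindlePaths p x y) where

    inside : Fin p → List Vertex
    inside i = internal (path S i)

    lastButOne : Fin p → Vertex
    lastButOne i = penultimate x (inside i)

    lastButOne-arc : ∀ i → lastButOne i ⟶ y
    lastButOne-arc i = penultimate-arc (inside i) (Path.linked (path S i))

    lastButOne-≢ : ∀ {i j} → i ≢ j → lastButOne i ≢ lastButOne j
    lastButOne-≢ {i} {j} i≢j = penultimate-≢ (inside i) (inside j)
      (Unique⇒head∉ (Path.unique (path S i))) (Unique⇒head∉ (Path.unique (path S j)))
      (SpindlePaths.distinct S i≢j) (SpindlePaths.disjoint S i≢j)

    next : Fin p → Vertex
    next i = second (inside i) y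

    next-arc : ∀ i → x ⟶ next i
    next-arc i = second-arc (inside i) (Path.linked (path S i))

    next-≢ : ∀ {i j} → i ≢ j → next i ≢ next j
    next-≢ {i} {j} i≢j = second-≢ (inside i) (inside j)
      (last∉ (path S i)) (last∉ (path S j))
      (SpindlePaths.distinct S i≢j) (SpindlePaths.disjoint S i≢j)
      where
      last∉ : (q : Path x y) → y ∉ internal q
      last∉ q with Path.unique q
      ... | _ ∷ u = Unique⇒last∉ (internal q) u

  -- By disjointness, `z` lies inside at most one of the three paths.
  twoPathsAvoid : ∀ {x y} (S : SpindlePaths 3 x y) z →
                  ∃[ i ] ∃[ j ] (i ≢ j × z ∉ inside S i × z ∉ inside S j)
  twoPathsAvoid S z with z ∈? inside S zero | z ∈? inside S (suc zero)
  ... | yes z∈0 | _ = suc zero , suc (suc zero) , (λ ()) ,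
    (λ z∈1 → SpindlePaths.disjoint S (λ ()) (z∈0 , z∈1)) ,
    (λ z∈2 → SpindlePaths.disjoint S (λ ()) (z∈0 , z∈2))
  ... | no z∉0 | yes z∈1 = zero , suc (suc zero) , (λ ()) , z∉0 ,
    (λ z∈2 → SpindlePaths.disjoint S (λ ()) (z∈1 , z∈2))
  ... | no z∉0 | no z∉1 = zero , suc zero , (λ ()) , z∉0 , z∉1

  -- Path `i` of `S` followed by path `i` of `T` is a closed walk. The two closed walks obtained
  -- share no internal vertices, so `z` is internal to at most one of them.
  cycleAvoids : ∀ {x y} (S : SpindlePaths 2 x y) (T : SpindlePaths 2 y x) →
                (∀ i j → Disjoint (inside S i) (inside T j)) → ∀ z →
                ∃[ i ] (z ∉ inside S i × z ∉ inside T i)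
  cycleAvoids S T dis z with z ∈? inside S zero | z ∈? inside T zero
  ... | yes z∈S | _ = suc zero ,
    (λ z∈S′ → SpindlePaths.disjoint S (λ ()) (z∈S , z∈S′)) ,
    (λ z∈T → dis zero (suc zero) (z∈S , z∈T))
  ... | no _ | yes z∈T = suc zero ,
    (λ z∈S → dis (suc zero) zero (z∈S , z∈T)) ,
    (λ z∈T′ → SpindlePaths.disjoint T (λ ()) (z∈T , z∈T′))
  ... | no z∉S | no z∉T = zero , z∉S , z∉T

  -- Colourings and the chromatic number

  Colourable-mono : m ≤ n → Colourable m → Colourable n
  Colourable-mono m≤n (c , proper) =
    (λ v → inject≤ (c v) m≤n) ,
    λ u v u~v eq → proper u v u~v (inject≤-injective m≤n m≤n _ _ eq)

  adjacent? : Decidable Adjacent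
  adjacent? u v with u ⟶? v | v ⟶? u
  ... | yes u⟶v | _       = yes (fwd u⟶v)
  ... | no _    | yes v⟶u = yes (bwd v⟶u)
  ... | no u↛v  | no v↛u  = no λ { (fwd u⟶v) → u↛v u⟶v ; (bwd v⟶u) → v↛u v⟶u }

  -- Searches the finitely many codes of functions. Decoding `funToFin c` gives back `c` only
  -- pointwise, which is enough to transfer properness.
  colourable? : ∀ m → Dec (Colourable m)
  colourable? m = map′
    (λ (i , proper) → finToFun i , proper)
    (λ (c , proper) → funToFin c , λ u v u~v eq → proper u v u~v
      (trans (sym (finToFun-funToFin c u)) (trans eq (finToFun-funToFin c v))))
    (Fin.any? λ i → all? λ u → all? λ v →
      adjacent? u v →-dec ¬? (finToFun {n = order} i u Fin.≟ finToFun i v))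

  -- Lowers the number of colours until this fails; by monotonicity no smaller number can then
  -- succeed.
  chromaticNumber : ∀ m → Colourable m → ∃ IsChromaticNumber
  chromaticNumber zero    col = zero , col , λ _ _ → z≤n
  chromaticNumber (suc m) col with colourable? m
  ... | yes col′ = chromaticNumber m col′
  ... | no ¬col  = suc m , col , λ _ col′ →
    ≮⇒≥ λ n<1+m → ¬col (Colourable-mono (s≤s⁻¹ n<1+m) col′)

  identityColouring : Colourable order
  identityColouring = id , λ where
    u .u (fwd u⟶u) refl → loopless refl u⟶u
    u .u (bwd u⟶u) refl → loopless refl u⟶u

-- Unambiguous relations

-- Equivalently, for acyclic R: there is at most one directed path between two
-- vertices.
Unambiguous : Rel A 0ℓ → Set
Unambiguous R = ∀ {a b b′ w} → Star R a b → Star R a b′ → R b w → R b′ w → b ≡ b′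

Proper : Rel A 0ℓ → (A → B) → Set
Proper R c = ∀ {u v} → R u v → c u ≢ c v

data Cone {A P I : Set} (R : Rel A 0ℓ) (t : P → I → A) : Rel (A ⊎ P) 0ℓ where
  old : ∀ {a b} → R a b → Cone R t (inj₁ a) (inj₁ b)
  new : ∀ p i → Cone R t (inj₁ (t p i)) (inj₂ p)

module _ {R : Rel A 0ℓ} {t : P → I → A} where

  Cone-Star⁻ : ∀ {a b} → Star (Cone R t) (inj₁ a) (inj₁ b) → Star R a b
  Cone-Star⁻ ε                     = ε
  Cone-Star⁻ (old r ◅ rs)          = r ◅ Cone-Star⁻ rs
  Cone-Star⁻ (new p i ◅ (() ◅ _))

  -- New vertices are sinks, so a path between old vertices is a path of `R`. Two arcs into an old
  -- vertex are thus settled by `una`, and two arcs into the new vertex `p` by `sep`, which lets `a`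
  -- reach only one member of the family `t p`.
  Cone-unambiguous : Unambiguous R →
                     (∀ p {a i j} → Star R a (t p i) → Star R a (t p j) → i ≡ j) →
                     Unambiguous (Cone R t)
  Cone-unambiguous una sep {inj₁ a} s s′ (old r) (old r′) =
    cong inj₁ (una (Cone-Star⁻ s) (Cone-Star⁻ s′) r r′)
  Cone-unambiguous una sep {inj₁ a} s s′ (new p i) (new .p j) =
    cong (inj₁ ∘ t p) (sep p (Cone-Star⁻ s) (Cone-Star⁻ s′))
  Cone-unambiguous una sep {inj₂ _} (() ◅ _) _ (old _) _
  Cone-unambiguous una sep {inj₂ _} (() ◅ _) _ (new _ _) _

  Cone-decidable : DecidableEquality A → Decidable R →
                   (∀ {Q : I → Set} → (∀ i → Dec (Q i)) → Dec (∃ Q)) →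
                   Decidable (Cone R t)
  Cone-decidable _≟_ R? search (inj₁ a) (inj₁ b) = map′ old (λ { (old r) → r }) (R? a b)
  Cone-decidable _≟_ R? search (inj₁ a) (inj₂ p) =
    map′ (λ { (i , refl) → new p i }) (λ { (new .p i) → i , refl }) (search λ i → t p i ≟ a)
  Cone-decidable _≟_ R? search (inj₂ p) _ = no λ ()

module _ {R : Rel A 0ℓ} {S : Rel B 0ℓ} where

  Pointwise-Star⁻₁ : ∀ {a z} → Star (Pointwise R S) (inj₁ a) z →
                     ∃[ b ] (z ≡ inj₁ b × Star R a b)
  Pointwise-Star⁻₁ ε = _ , refl , ε
  Pointwise-Star⁻₁ (inj₁ r ◅ rs) with b , eq , rs′ ← Pointwise-Star⁻₁ rs = b , eq , r ◅ rs′

  Pointwise-Star⁻₂ : ∀ {a z} → Star (Pointwise R S) (inj₂ a) z →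
                     ∃[ b ] (z ≡ inj₂ b × Star S a b)
  Pointwise-Star⁻₂ ε = _ , refl , ε
  Pointwise-Star⁻₂ (inj₂ r ◅ rs) with b , eq , rs′ ← Pointwise-Star⁻₂ rs = b , eq , r ◅ rs′

  Pointwise-unambiguous : Unambiguous R → Unambiguous S → Unambiguous (Pointwise R S)
  Pointwise-unambiguous unaR unaS {inj₁ _} s s′ r r′
    with _ , refl , t ← Pointwise-Star⁻₁ s | _ , refl , t′ ← Pointwise-Star⁻₁ s′
    with inj₁ q ← r | inj₁ q′ ← r′ = cong inj₁ (unaR t t′ q q′)
  Pointwise-unambiguous unaR unaS {inj₂ _} s s′ r r′
    with _ , refl , t ← Pointwise-Star⁻₂ s | _ , refl , t′ ← Pointwise-Star⁻₂ s′
    with inj₂ q ← r | inj₂ q′ ← r′ = cong inj₂ (unaS t t′ q q′)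

-- Zykov's graphs

-- Base k is the disjoint union of the first k Zykov graphs and Tuple k is their
-- product; the apex of a tuple is joined to all its members.
mutual
  Zykov : ℕ → Set
  Zykov k = Base k ⊎ Tuple k

  Base : ℕ → Set
  Base zero    = ⊥
  Base (suc k) = Base k ⊎ Zykov k

  Tuple : ℕ → Set
  Tuple zero    = ⊤
  Tuple (suc k) = Tuple k × Zykov k

-- Index zero is the component from the latest graph; distinct indices lie in distinct summands of
-- `Base k`.
member : ∀ k → Tuple k → Fin k → Base k
member (suc k) (p , v) zero    = inj₂ v
member (suc k) (p , v) (suc i) = inj₁ (member k p i)

mutual
  Arc : ∀ k → Rel (Zykov k) 0ℓ
  Arc k = Cone (BaseArc k) (member k)

  BaseArc : ∀ k → Rel (Base k) 0ℓ
  BaseArc zero    = λ _ _ → ⊥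
  BaseArc (suc k) = Pointwise (BaseArc k) (Arc k)

-- Shows that every Zykov graph has an apex, hence a vertex.
aTuple : ∀ k → Tuple k
aTuple zero    = tt
aTuple (suc k) = aTuple k , inj₂ (aTuple k)

mutual
  Zykov-finite : ∀ k → ∃[ n ] (Fin n ↔ Zykov k)
  Zykov-finite k =
    let _ , b = Base-finite k ; _ , t = Tuple-finite k
    in _ , ↔-trans +↔⊎ (b ⊎-↔ t)

  Base-finite : ∀ k → ∃[ n ] (Fin n ↔ Base k)
  Base-finite zero    = 0 , 0↔⊥
  Base-finite (suc k) =
    let _ , b = Base-finite k ; _ , z = Zykov-finite k
    in _ , ↔-trans +↔⊎ (b ⊎-↔ z)

  Tuple-finite : ∀ k → ∃[ n ] (Fin n ↔ Tuple k)
  Tuple-finite zero    = 1 , 1↔⊤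
  Tuple-finite (suc k) =
    let _ , t = Tuple-finite k ; _ , z = Zykov-finite k
    in _ , ↔-trans *↔× (t ×-↔ z)

_≟ᴮ_ : DecidableEquality (Base k)
_≟ᴮ_ {k} = via-injection (↔⇒↣ (↔-sym (proj₂ (Base-finite k)))) Fin._≟_

mutual
  Arc? : ∀ k → Decidable (Arc k)
  Arc? k = Cone-decidable _≟ᴮ_ (BaseArc? k) Fin.any?

  BaseArc? : ∀ k → Decidable (BaseArc k)
  BaseArc? zero    ()
  BaseArc? (suc k) = ⊎-decidable (BaseArc? k) (Arc? k)

-- Acyclicity and unambiguity of Zykov's graphs

mutual
  -- The stage at which the vertex was added as an apex. Strict growth along arcs is the form in
  -- which acyclicity is used.
  rank : ∀ k → Zykov k → ℕ
  rank k (inj₁ b) = baseRank k b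
  rank k (inj₂ _) = k

  baseRank : ∀ k → Base k → ℕ
  baseRank (suc k) (inj₁ b) = baseRank k b
  baseRank (suc k) (inj₂ v) = rank k v

mutual
  rank< : ∀ k v → rank k v < suc k
  rank< k (inj₁ b) = m<n⇒m<1+n (baseRank< k b)
  rank< k (inj₂ _) = n<1+n k

  baseRank< : ∀ k b → baseRank k b < k
  baseRank< (suc k) (inj₁ b) = m<n⇒m<1+n (baseRank< k b)
  baseRank< (suc k) (inj₂ v) = rank< k v

mutual
  rank-mono : ∀ k → Arc k =[ rank k ]⇒ _<_
  rank-mono k (old r)   = baseRank-mono k r
  rank-mono k (new p i) = baseRank< k (member k p i)

  baseRank-mono : ∀ k → BaseArc k =[ baseRank k ]⇒ _<_
  baseRank-mono (suc k) (inj₁ r) = baseRank-mono k r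
  baseRank-mono (suc k) (inj₂ r) = rank-mono k r

-- A path never leaves its summand of `Base k`, and each summand holds just one member of the tuple.
member-separated : ∀ k p {a i j} → Star (BaseArc k) a (member k p i) →
                   Star (BaseArc k) a (member k p j) → i ≡ j
member-separated (suc k) _ {_}      {zero}  {zero}  s s′ = refl
member-separated (suc k) _ {inj₁ a} {zero}  {suc j} s s′ with () ← proj₁ (proj₂ (Pointwise-Star⁻₁ s))
member-separated (suc k) _ {inj₂ a} {zero}  {suc j} s s′ with () ← proj₁ (proj₂ (Pointwise-Star⁻₂ s′))
member-separated (suc k) _ {inj₁ a} {suc i} {zero}  s s′ with () ← proj₁ (proj₂ (Pointwise-Star⁻₁ s′))
member-separated (suc k) _ {inj₂ a} {suc i} {zero}  s s′ with () ← proj₁ (proj₂ (Pointwise-Star⁻₂ s))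
member-separated (suc k) _ {inj₂ a} {suc i} {suc j} s s′ with () ← proj₁ (proj₂ (Pointwise-Star⁻₂ s))
member-separated (suc k) (p , _) {inj₁ a} {suc i} {suc j} s s′
  with _ , refl , t ← Pointwise-Star⁻₁ s | _ , refl , t′ ← Pointwise-Star⁻₁ s′ =
  cong suc (member-separated k p t t′)

mutual
  Arc-unambiguous : ∀ k → Unambiguous (Arc k)
  Arc-unambiguous k = Cone-unambiguous (BaseArc-unambiguous k) (member-separated k)

  BaseArc-unambiguous : ∀ k → Unambiguous (BaseArc k)
  BaseArc-unambiguous zero    {()}
  BaseArc-unambiguous (suc k) =
    Pointwise-unambiguous (BaseArc-unambiguous k) (Arc-unambiguous k)

-- Many colours in every proper colouring

cons-injective : {f : Fin (suc k) → A} → (∀ i → f zero ≢ f (suc i)) →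
                 Injective _≡_ _≡_ (f ∘ suc) → Injective _≡_ _≡_ f
cons-injective f₀∉ inj {zero}  {zero}  eq = refl
cons-injective f₀∉ inj {zero}  {suc j} eq = contradiction eq (f₀∉ j)
cons-injective f₀∉ inj {suc i} {zero}  eq = contradiction (sym eq) (f₀∉ i)
cons-injective f₀∉ inj {suc i} {suc j} eq = cong suc (inj eq)

-- If `f` took every value of `g`, choosing preimages would map `suc k` indices to `k`; two would
-- collide, against injectivity of `g`.
fresh : (f : Fin k → Fin m) {g : Fin (suc k) → Fin m} → Injective _≡_ _≡_ g →
        ∃[ j ] ∀ i → g j ≢ f i
fresh f {g} g-inj =
  let j , ∄ = ¬∀⟶∃¬ _ (λ j → ∃[ i ] g j ≡ f i) (λ j → Fin.any? λ i → g j Fin.≟ f i) missed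
  in j , λ i eq → ∄ (i , eq)
  where
  missed : ¬ (∀ j → ∃[ i ] g j ≡ f i)
  missed hit with i , j , i<j , eq ← pigeonhole (n<1+n _) (proj₁ ∘ hit) =
    <⇒≢ i<j (g-inj (trans (proj₂ (hit i)) (trans (cong f eq) (sym (proj₂ (hit j))))))

mutual
  -- The apex of a rainbow tuple is joined to all its `k` members, so its colour is one more.
  rainbow : ∀ k (c : Zykov k → Fin m) → Proper (Arc k) c →
            Σ[ w ∈ (Fin (suc k) → Zykov k) ] Injective _≡_ _≡_ (c ∘ w)
  rainbow k c proper with p , inj ← rainbowTuple k (c ∘ inj₁) (proper ∘ old) =
    (λ { zero → inj₂ p ; (suc i) → inj₁ (member k p i) }) ,
    cons-injective (λ i eq → proper (new p i) (sym eq)) inj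

  -- Greedy choice: the next graph shows `suc k` colours, and at most `k` of them are taken by the
  -- members chosen before.
  rainbowTuple : ∀ k (c : Base k → Fin m) → Proper (BaseArc k) c →
                 Σ[ p ∈ Tuple k ] Injective _≡_ _≡_ (c ∘ member k p)
  rainbowTuple zero    c proper = tt , λ { {()} }
  rainbowTuple (suc k) c proper
    with p , p-inj ← rainbowTuple k (c ∘ inj₁) (proper ∘ inj₁)
       | w , w-inj ← rainbow k (c ∘ inj₂) (proper ∘ inj₂)
    with j , new-colour ← fresh (c ∘ inj₁ ∘ member k p) w-inj
    = (p , w j) , cons-injective new-colour p-inj

Zykov-uncolourable : ∀ k (c : Zykov k → Fin k) → ¬ Proper (Arc k) c
Zykov-uncolourable k c proper = 1+n≰n (injective⇒≤ (proj₂ (rainbow k c proper)))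

-- Closing up an acyclic unambiguous digraph

module Closure
  -- The successor ensures that a first entry and a last exit exist.
  {V : Set} {n} (index : Fin (suc n) ↔ V)
  {E : Rel V 0ℓ} (E? : Decidable E)
  (height : V → ℕ) {h} (height< : ∀ v → height v < h)
  (height-mono : E =[ height ]⇒ _<_)
  (unambiguous : Unambiguous E)
  where

  data Node : Set where
    entry : Fin (suc n) → Node
    core  : V → Node
    exit  : Fin (suc n) → Node

  ind : V → Fin (suc n)
  ind = Inverse.from index

  infix 4 _⇒_ _⇒?_ _⇛_

  data _⇒_ : Rel Node 0ℓ where
    entry-entry : ∀ {i j} → suc (toℕ i) ≡ toℕ j → entry i ⇒ entry j
    entry-core  : ∀ v → entry (ind v) ⇒ core v
    core-core   : ∀ {u v} → E u v → core u ⇒ core v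
    core-exit   : ∀ u → core u ⇒ exit (ind u)
    exit-exit   : ∀ {i j} → suc (toℕ i) ≡ toℕ j → exit i ⇒ exit j
    last-first  : exit (fromℕ n) ⇒ entry zero

  _⇒?_ : Decidable _⇒_
  entry i ⇒? entry j = map′ entry-entry (λ { (entry-entry eq) → eq }) (suc (toℕ i) ℕ.≟ toℕ j)
  entry i ⇒? core v  = map′ (λ { refl → entry-core v }) (λ { (entry-core _) → refl }) (i Fin.≟ ind v)
  entry i ⇒? exit j  = no λ ()
  core u  ⇒? entry j = no λ ()
  core u  ⇒? core v  = map′ core-core (λ { (core-core e) → e }) (E? u v)
  core u  ⇒? exit j  = map′ (λ { refl → core-exit u }) (λ { (core-exit _) → refl }) (ind u Fin.≟ j)
  exit i  ⇒? entry j = map′ (λ { (refl , refl) → last-first }) (λ { last-first → refl , refl })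
                            (i Fin.≟ fromℕ n ×-dec j Fin.≟ zero)
  exit i  ⇒? core v  = no λ ()
  exit i  ⇒? exit j  = map′ exit-exit (λ { (exit-exit eq) → eq }) (suc (toℕ i) ℕ.≟ toℕ j)

  ⇒-irreflexive : ∀ {w} → ¬ w ⇒ w
  ⇒-irreflexive (entry-entry eq) = 1+n≢n eq
  ⇒-irreflexive (core-core e)    = <-irrefl refl (height-mono e)
  ⇒-irreflexive (exit-exit eq)   = 1+n≢n eq

  -- The arcs other than the one from the last exit to the first entry.
  _⇛_ : Rel Node 0ℓ
  a ⇛ b = a ⇒ b × b ≢ entry zero

  -- Entries fill the levels up to `n`, core vertices the next `h`, and exits those above, so every
  -- arc but the closing one goes up.
  level : Node → ℕ
  level (entry i) = toℕ i
  level (core v)  = suc n + height v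
  level (exit i)  = suc n + (h + toℕ i)

  level-mono : ∀ {a b} → a ⇛ b → level a < level b
  level-mono (entry-entry eq , _) = ℕ.≤-reflexive eq
  level-mono (entry-core v , _)   = <-≤-trans (toℕ<n (ind v)) (m≤m+n (suc n) _)
  level-mono (core-core e , _)    = +-monoʳ-< (suc n) (height-mono e)
  level-mono (core-exit u , _)    = +-monoʳ-< (suc n) (<-≤-trans (height< u) (m≤m+n h _))
  level-mono (exit-exit eq , _)   = +-monoʳ-< (suc n) (+-monoʳ-< h (ℕ.≤-reflexive eq))
  level-mono (last-first , ne)    = contradiction refl ne

  level-Star : ∀ {a b} → Star _⇛_ a b → level a ≤ level b
  level-Star ε        = ≤-refl
  level-Star (s ◅ ss) = ≤-trans (<⇒≤ (level-mono s)) (level-Star ss)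

  exit↛core : ∀ {i b v} → Star _⇛_ (exit i) b → ¬ b ⇒ core v
  exit↛core ε                      ()
  exit↛core ((exit-exit _ , _) ◅ ss) e = exit↛core ss e
  exit↛core ((last-first , ne) ◅ _)  _ = ne refl

  -- Without the closing arc, a walk that leaves the core stays among the exits, and no exit has an
  -- arc into the core.
  Star-core⁻ : ∀ {u b v} → Star _⇛_ (core u) b → b ⇒ core v →
               ∃[ w ] (b ≡ core w × Star E u w × E w v)
  Star-core⁻ ε (core-core e) = _ , refl , ε , e
  Star-core⁻ ((core-core e , _) ◅ ss) e′
    with w , eq , es , e″ ← Star-core⁻ ss e′ = w , eq , e ◅ es , e″
  Star-core⁻ ((core-exit _ , _) ◅ ss) e′ = contradiction e′ (exit↛core ss)

  -- In- and out-neighbours of entries and exits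

  -- A two-valued label that tells apart the in-neighbours of any entry or exit: at most one is an
  -- exit and at most one is not. `entry?` does the same for out-neighbours.
  exit? : Node → Fin 2
  exit? (exit _) = suc zero
  exit? _        = zero

  entry? : Node → Fin 2
  entry? (entry _) = suc zero
  entry? _         = zero

  toℕ-pred : ∀ {i j l : Fin (suc n)} → suc (toℕ i) ≡ toℕ l → suc (toℕ j) ≡ toℕ l → i ≡ j
  toℕ-pred p q = toℕ-injective (suc-injective (trans p (sym q)))

  toℕ-succ : ∀ {i j l : Fin (suc n)} → suc (toℕ l) ≡ toℕ i → suc (toℕ l) ≡ toℕ j → i ≡ j
  toℕ-succ p q = toℕ-injective (trans (sym p) q)

  ind-injective : ∀ {u v} → ind u ≡ ind v → u ≡ v
  ind-injective {u} {v} eq = trans (sym (Inverse.strictlyInverseˡ index u))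
    (trans (cong (Inverse.to index) eq) (Inverse.strictlyInverseˡ index v))

  into-entry : ∀ {a b l} → a ⇒ entry l → b ⇒ entry l → exit? a ≡ exit? b → a ≡ b
  into-entry (entry-entry p) (entry-entry q) _ = cong entry (toℕ-pred p q)
  into-entry last-first      last-first      _ = refl

  -- The equation `i ≡ j` is kept apart because `ind u` and `ind v` do not unify when both arcs are
  -- matched; `from-entry` is stated likewise.
  into-exit : ∀ {a b i j} → a ⇒ exit i → b ⇒ exit j → i ≡ j → exit? a ≡ exit? b → a ≡ b
  into-exit (core-exit u) (core-exit v) eq   _ = cong core (ind-injective eq)
  into-exit (exit-exit p) (exit-exit q) refl _ = cong exit (toℕ-pred p q)

  from-entry : ∀ {a b i j} → entry i ⇒ a → entry j ⇒ b → i ≡ j → entry? a ≡ entry? b → a ≡ b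
  from-entry (entry-entry p) (entry-entry q) refl _ = cong entry (toℕ-succ p q)
  from-entry (entry-core u)  (entry-core v)  eq   _ = cong core (ind-injective eq)

  from-exit : ∀ {a b l} → exit l ⇒ a → exit l ⇒ b → entry? a ≡ entry? b → a ≡ b
  from-exit (exit-exit p) (exit-exit q) _ = cong exit (toℕ-succ p q)
  from-exit last-first    last-first    _ = refl

  in-arcs : ∀ w → (∃[ v ] w ≡ core v) ⊎
            (∀ {a b} → a ⇒ w → b ⇒ w → exit? a ≡ exit? b → a ≡ b)
  in-arcs (entry _) = inj₂ into-entry
  in-arcs (core v)  = inj₁ (v , refl)
  in-arcs (exit _)  = inj₂ λ e e′ → into-exit e e′ refl

  out-arcs : ∀ w → (∃[ v ] w ≡ core v) ⊎
             (∀ {a b} → w ⇒ a → w ⇒ b → entry? a ≡ entry? b → a ≡ b)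
  out-arcs (entry _) = inj₂ λ e e′ → from-entry e e′ refl
  out-arcs (core v)  = inj₁ (v , refl)
  out-arcs (exit _)  = inj₂ from-exit

  -- Strong connectivity

  ⇒first : ∀ {a} → a ⇒ entry zero → a ≡ exit (fromℕ n)
  ⇒first last-first = refl

  first⇒* : ∀ i → Star _⇒_ (entry zero) (entry i)
  first⇒* = <-weakInduction (λ i → Star _⇒_ (entry zero) (entry i)) ε
    λ i s → s ◅◅ (entry-entry (cong suc (toℕ-inject₁ i)) ◅ ε)

  *⇒last : ∀ i → Star _⇒_ (exit i) (exit (fromℕ n))
  *⇒last = >-weakInduction (λ i → Star _⇒_ (exit i) (exit (fromℕ n))) ε
    λ i s → exit-exit (cong suc (toℕ-inject₁ i)) ◅ s

  -- Goes through the core vertex numbered `i`, which exists because `index` is a bijection.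
  entry⇒*exit : ∀ i → Star _⇒_ (entry i) (exit i)
  entry⇒*exit i = subst (λ j → Star _⇒_ (entry j) (exit j)) (Inverse.strictlyInverseʳ index i)
    (entry-core v ◅ core-exit v ◅ ε)
    where v = Inverse.to index i

  from-first : ∀ w → Star _⇒_ (entry zero) w
  from-first (entry i) = first⇒* i
  from-first (core v)  = first⇒* (ind v) ◅◅ (entry-core v ◅ ε)
  from-first (exit i)  = first⇒* i ◅◅ entry⇒*exit i

  to-last : ∀ w → Star _⇒_ w (exit (fromℕ n))
  to-last (entry i) = entry⇒*exit i ◅◅ *⇒last i
  to-last (core v)  = core-exit v ◅ *⇒last (ind v)
  to-last (exit i)  = *⇒last i

  connected : ∀ a b → Star _⇒_ a b
  connected a b = to-last a ◅◅ (last-first ◅ from-first b)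

  -- Abstract, so that vertices are not unfolded to sums during unification.
  abstract
    nodes : Fin (suc n + (suc n + suc n)) ↔ Node
    nodes = ↔-trans +↔⊎ (↔-trans (↔-id _ ⊎-↔ ↔-trans +↔⊎ (index ⊎-↔ ↔-id _)) sum↔Node)
      where
      sum↔Node : (Fin (suc n) ⊎ V ⊎ Fin (suc n)) ↔ Node
      sum↔Node = mk↔ₛ′
        (λ { (inj₁ i) → entry i ; (inj₂ (inj₁ v)) → core v ; (inj₂ (inj₂ i)) → exit i })
        (λ { (entry i) → inj₁ i ; (core v) → inj₂ (inj₁ v) ; (exit i) → inj₂ (inj₂ i) })
        (λ { (entry _) → refl ; (core _) → refl ; (exit _) → refl })
        (λ { (inj₁ _) → refl ; (inj₂ (inj₁ _)) → refl ; (inj₂ (inj₂ _)) → refl })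

  open Inverse nodes using () renaming
    (to to node; from to code; strictlyInverseˡ to node-code; strictlyInverseʳ to code-node)

  node-injective : ∀ {x y} → node x ≡ node y → x ≡ y
  node-injective {x} {y} eq = trans (sym (code-node x)) (trans (cong code eq) (code-node y))

  closure : Digraph
  closure = record
    { order    = _
    ; _⟶_      = _⇒_ on node
    ; _⟶?_     = λ x y → node x ⇒? node y
    ; loopless = λ { refl → ⇒-irreflexive }
    }

  open Digraph closure
  open DigraphProperties closure

  code-arc : ∀ {a b} → a ⇒ b → code a ⟶ code b
  code-arc = subst₂ _⇒_ (sym (node-code _)) (sym (node-code _))

  stronglyConnected : StronglyConnected
  stronglyConnected x y x≢y = Star⇒Path
    (subst₂ (Star _⟶_) (code-node x) (code-node y)
      (gmap code code-arc (connected (node x) (node y)))) x≢y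

  colouring-restricts : Colourable m → Σ[ c ∈ (V → Fin m) ] Proper E c
  colouring-restricts (c , proper) =
    (λ v → c (code (core v))) , λ e → proper _ _ (fwd (code-arc (core-core e)))

  -- Excluding spindles and bispindles

  first : Vertex
  first = code (entry zero)

  node≡first : ∀ {x} → node x ≡ entry zero → x ≡ first
  node≡first eq = node-injective (trans eq (sym (node-code _)))

  module _ {x y : Vertex} (p : Path x y) (avoids : first ∉ internal p) where

    avoiding-Star : Star _⇛_ (node x) (node (penultimate x (internal p)))
    avoiding-Star = gmap node (λ (arc , b≢first) → arc , λ eq → b≢first (sym (node≡first eq)))
      (Linked⇒Star (internal p) (Path.linked p) (¬Any⇒All¬ _ avoids))

    avoiding-level : y ≢ first → level (node x) < level (node y)
    avoiding-level y≢first = ≤-<-trans (level-Star avoiding-Star)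
      (level-mono (penultimate-arc (internal p) (Path.linked p) , y≢first ∘ node≡first))

  no-3-spindle : ¬ ContainsSpindle 3
  no-3-spindle (x , y , _ , S) with in-arcs (node y) | out-arcs (node x)
  -- Two of the three penultimate vertices share one of the two labels and therefore coincide.
  ... | inj₂ in≤2 | _ =
    let i , j , i<j , eq = pigeonhole (n<1+n 2) (exit? ∘ node ∘ lastButOne S)
    in lastButOne-≢ S (<⇒≢ i<j)
         (node-injective (in≤2 (lastButOne-arc S i) (lastButOne-arc S j) eq))
  ... | inj₁ _ | inj₂ out≤2 =
    let i , j , i<j , eq = pigeonhole (n<1+n 2) (entry? ∘ node ∘ next S)
    in next-≢ S (<⇒≢ i<j)
         (node-injective (out≤2 (next-arc S i) (next-arc S j) eq))
  ... | inj₁ (v , y≡v) | inj₁ (u , x≡u) =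
    let i , j , i≢j , avoid-i , avoid-j = twoPathsAvoid S first
        _ , eq-i , path-i , arc-i = inCore i avoid-i
        _ , eq-j , path-j , arc-j = inCore j avoid-j
    in lastButOne-≢ S i≢j (node-injective (trans eq-i
         (trans (cong core (unambiguous path-i path-j arc-i arc-j)) (sym eq-j))))
    where
    inCore : ∀ i → first ∉ inside S i →
             ∃[ w ] (node (lastButOne S i) ≡ core w × Star E u w × E w v)
    inCore i avoids = Star-core⁻
      (subst (λ a → Star _⇛_ a (node (lastButOne S i))) x≡u (avoiding-Star (path S i) avoids))
      (subst (node (lastButOne S i) ⇒_) y≡v (lastButOne-arc S i))

  -- Covers bispindles with the first entry as an end, which every cycle through both ends meets.
  -- Its only in-neighbour is the last exit, but two paths need distinct penultimate vertices.
  no-2-spindle-to-first : ∀ {x} → ¬ SpindlePaths 2 x first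
  no-2-spindle-to-first S = lastButOne-≢ S {zero} {suc zero} (λ ())
    (node-injective (trans (unique-source zero) (sym (unique-source (suc zero)))))
    where
    unique-source : ∀ i → node (lastButOne S i) ≡ exit (fromℕ n)
    unique-source i = ⇒first (subst (node (lastButOne S i) ⇒_) (node-code _) (lastButOne-arc S i))

  no-2+2-bispindle : ¬ ContainsBispindle 2 2
  no-2+2-bispindle (x , y , _ , S , T , dis) with x Fin.≟ first | y Fin.≟ first
  ... | yes refl | _        = no-2-spindle-to-first T
  ... | no _     | yes refl = no-2-spindle-to-first S
  ... | no x≢f   | no y≢f   =
    let i , avoidS , avoidT = cycleAvoids S T dis first
    -- The level would rise strictly from `x` to `y` and again from `y` back to `x`.
    in <-irrefl refl (<-trans (avoiding-level (path S i) avoidS y≢f)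
                              (avoiding-level (path T i) avoidT x≢f))

-- The closure of a Zykov graph

Zykov-index : ∀ k → ∃[ n ] (Fin (suc n) ↔ Zykov k)
Zykov-index k with Zykov-finite k
... | zero  , index = contradiction (Inverse.from index (inj₂ (aTuple k))) Fin.¬Fin0
... | suc n , index = n , index

i≤∣i∣ : ∀ i → i ℤ.≤ + ∣ i ∣
i≤∣i∣ (+ n)     = ℤ.+≤+ ≤-refl
i≤∣i∣ -[1+ n ] = ℤ.-≤+

mainTheorem1 : (k : ℤ) →
    Σ[ D ∈ Digraph ]
    (Digraph.StronglyConnected D
    × (∃[ χ ] (Digraph.IsChromaticNumber D χ × + χ > k))
    × ¬ Digraph.ContainsSpindle D 3
    × ¬ Digraph.ContainsBispindle D 2 2)
mainTheorem1 k =
  closure , stronglyConnected , (χ , isχ , χ>k) , no-3-spindle , no-2+2-bispindle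
  where
  -- Negative `k` is allowed; since `k` is at most `K`, more than `K` colours suffice.
  K = ∣ k ∣
  open Closure (proj₂ (Zykov-index K)) (Arc? K) (rank K) (rank< K) (rank-mono K) (Arc-unambiguous K)
  open DigraphProperties closure
  χ,isχ = chromaticNumber _ identityColouring
  χ = proj₁ χ,isχ
  isχ = proj₂ χ,isχ
  χ>k : + χ > k
  -- If `χ` were at most `K`, the closure would have a proper colouring with `K` colours, and so
  -- would the Zykov graph at its core.
  χ>k = ℤ.≤-<-trans (i≤∣i∣ k) (ℤ.+<+ (ℕ.≰⇒> λ χ≤K →
    let c , proper = colouring-restricts (Colourable-mono χ≤K (proj₁ isχ))
    in Zykov-uncolourable K c proper))
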